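{- Let $\sigma,n\ge2$ be integers with $\sigma\le n$. Any data structure supporting suffix array queries for every text $T\in[0..\sigma)^n$ has worst-case space usage $\Omega(n\log\sigma)$ bits; that is, there is an absolute constant $\delta>0$ such that for all integers $2\le\sigma\le n$, any such data structure uses at least $\delta\,n\log\sigma$ bits on some $T\in[0..\sigma)^n$.
   Context: Here $[0..\sigma)=\{0,\dots,\sigma-1\}$ and $\log$ is base 2. For a text $T$ of length $n$, the suffix array $\mathrm{SA}_T[1..n]$ is the permutation of $\{1,\dots,n\}$ such that $T[\mathrm{SA}_T[1]..n]\prec\cdots\prec T[\mathrm{SA}_T[n]..n]$ lexicographically (a proper prefix of a string precedes that string). A suffix array query takes $i\in\{1,\dots,n\}$ and returns $\mathrm{SA}_T[i]$. A data structure supporting a query problem for a family of inputs (with parameters $\sigma,n$ fixed) assigns to each input a finite bit string; the answer to every query on an input is determined by the stored bit string and the query arguments only. The space used on an input is the length of its bit string, and the worst-case space usage is the maximum over all inputs in the family. Query time is irrelevant. -}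

module Defs where

open import Data.Bool.Base using (Bool)
open import Data.Fin.Base as Fin using (Fin; zero; suc; toℕ; cast)
open import Data.Fin.Induction using (<-weakInduction)
open import Data.Fin.Permutation as Perm
  using (Permutation′; _⟨$⟩ʳ_; _⟨$⟩ˡ_; _∘ₚ_; inverseˡ; inverseʳ)
import Data.Fin.Properties as Fin
open import Data.Integer.Base using (∣_∣)
open import Data.List.Base as List using (List; length; drop; allFin)
open import Data.List.Properties using (length-drop; length-tabulate; lookup-tabulate)
open import Data.List.Relation.Binary.Lex.Strict as Lex using (Lex-<; Lex-≤; base; halt; this; next)
open import Data.List.Relation.Binary.Permutation.Propositional using (↭⇒↭ₛ)
open import Data.List.Relation.Binary.Permutation.Homogeneous using (onIndices)
import Data.List.Relation.Binary.Permutation.Setoid.Properties as ↭ₛ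
import Data.List.Relation.Binary.Pointwise as Pointwise
import Data.List.Relation.Unary.Sorted.TotalOrder.Properties as Sorted
import Data.List.Sort as Sort
open import Data.Nat.Base as ℕ using (ℕ; suc; _*_; _^_; _∸_; _≤_; z≤n)
import Data.Nat.Properties as ℕ
open import Data.Product.Base using (∃; _,_; proj₁)
open import Data.Rational.Base using (ℚ; ↥_; ↧ₙ_)
open import Data.Vec.Base using (Vec; toList)
open import Data.Vec.Properties using (length-toList)
open import Level using (0ℓ)
open import Relation.Binary.Bundles using (DecTotalOrder)
open import Relation.Binary.Definitions using (tri<; tri≈; tri>)
import Relation.Binary.Construct.On as On
open import Relation.Binary.PropositionalEquality
  using (_≡_; _≢_; refl; sym; trans; cong; subst; subst₂; setoid; resp₂)
open import Relation.Nullary.Negation using (contradiction; ¬_)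

private
  variable
    σ n : ℕ

-- The alphabet [0..σ) is Fin σ. Positions 1, …, n, both in texts and in
-- suffix arrays, are shifted to 0, …, n - 1 and represented by Fin n.

Text : ℕ → ℕ → Set
Text σ n = Vec (Fin σ) n

suffix : Text σ n → Fin n → List (Fin σ)
suffix T p = drop (toℕ p) (toList T)

infix 4 _≺_

_≺_ : List (Fin σ) → List (Fin σ) → Set
_≺_ = Lex-< _≡_ Fin._<_

IsSuffixArray : Text σ n → Permutation′ n → Set
IsSuffixArray T π = ∀ {i j} → i Fin.< j → suffix T (π ⟨$⟩ʳ i) ≺ suffix T (π ⟨$⟩ʳ j)

suffix-length : (T : Text σ n) (p : Fin n) → length (suffix T p) ≡ n ∸ toℕ p
suffix-length T p =
  trans (length-drop (toℕ p) (toList T)) (cong (_∸ toℕ p) (length-toList T))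

suffix-length-injective : (T : Text σ n) {p q : Fin n} →
                          length (suffix T p) ≡ length (suffix T q) → p ≡ q
suffix-length-injective T {p} {q} eq = Fin.toℕ-injective
  (ℕ.∸-cancelˡ-≡ (ℕ.<⇒≤ (Fin.toℕ<n p)) (ℕ.<⇒≤ (Fin.toℕ<n q))
    (trans (sym (suffix-length T p)) (trans eq (suffix-length T q))))

≺-irrefl : {xs : List (Fin σ)} → ¬ xs ≺ xs
≺-irrefl = Lex.<-irreflexive Fin.<-irrefl (Pointwise.refl refl)

≺-asym : {xs ys : List (Fin σ)} → xs ≺ ys → ¬ ys ≺ xs
≺-asym = Lex.<-asymmetric sym (resp₂ Fin._<_) Fin.<-asym

private
  ≤⇒≺ : {xs ys : List (Fin σ)} → Lex-≤ _≡_ Fin._<_ xs ys →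
        length xs ≢ length ys → xs ≺ ys
  ≤⇒≺ (base _)      ne = contradiction refl ne
  ≤⇒≺ halt          ne = halt
  ≤⇒≺ (this x<y)    ne = this x<y
  ≤⇒≺ (next eq x≤y) ne = next eq (≤⇒≺ x≤y (λ e → ne (cong suc e)))

suffixOrder : Text σ n → DecTotalOrder 0ℓ 0ℓ 0ℓ
suffixOrder {σ} T = On.decTotalOrder (Lex.≤-decTotalOrder (Fin.<-strictTotalOrder σ)) (suffix T)

suffixArray-exists : (T : Text σ n) → ∃ (IsSuffixArray T)
suffixArray-exists {σ} {n} T = π , π-mono
  where
  module O = DecTotalOrder (suffixOrder T)
  open Sort (suffixOrder T) using (sort; sort-↭; sort-↗)

  sorted : List (Fin n)
  sorted = sort (allFin n)

  sorted↭ = ↭⇒↭ₛ (sort-↭ (allFin n))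

  len-allFin : length (allFin n) ≡ n
  len-allFin = length-tabulate (λ i → i)

  len-sorted : length sorted ≡ n
  len-sorted = trans (Perm.↔⇒≡ (onIndices sorted↭)) len-allFin

  π : Permutation′ n
  π = Perm.cast-id (sym len-sorted) ∘ₚ onIndices sorted↭ ∘ₚ Perm.cast-id len-allFin

  lookup-allFin : ∀ k → List.lookup (allFin n) k ≡ cast len-allFin k
  lookup-allFin k = trans
    (cong (List.lookup (allFin n))
      (sym (Fin.cast-involutive (sym len-allFin) len-allFin k)))
    (lookup-tabulate (λ i → i) (cast len-allFin k))

  π-lookup : ∀ i → List.lookup sorted (cast (sym len-sorted) i) ≡ π ⟨$⟩ʳ i
  π-lookup i = trans
    (↭ₛ.onIndices-lookup (setoid (Fin n)) sorted↭ (cast (sym len-sorted) i))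
    (lookup-allFin _)

  π-mono : IsSuffixArray T π
  π-mono {i} {j} i<j = ≤⇒≺
    (subst₂ O._≤_ (π-lookup i) (π-lookup j)
      (Sorted.lookup-mono-≤ O.totalOrder (sort-↗ (allFin n))
        (subst₂ _≤_ (sym (Fin.toℕ-cast _ i)) (sym (Fin.toℕ-cast _ j)) (ℕ.<⇒≤ i<j))))
    (λ eq → Fin.<⇒≢ i<j (trans (sym (inverseˡ π))
      (trans (cong (π ⟨$⟩ˡ_) (suffix-length-injective T eq)) (inverseˡ π))))

private
  mono⇒inflationary : (f : Fin n → Fin n) → (∀ {i j} → i Fin.< j → f i Fin.< f j) →
                      ∀ i → i Fin.≤ f i
  mono⇒inflationary {suc n} f mono = <-weakInduction (λ i → i Fin.≤ f i) z≤n step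
    where
    step : ∀ i → Fin.inject₁ i Fin.≤ f (Fin.inject₁ i) → suc i Fin.≤ f (suc i)
    step i ih = ℕ.≤-<-trans (subst (_≤ toℕ (f (Fin.inject₁ i))) (Fin.toℕ-inject₁ i) ih)
      (mono (ℕ.s≤s (ℕ.≤-reflexive (Fin.toℕ-inject₁ i))))

  reindex-mono : (T : Text σ n) (π ρ : Permutation′ n) →
                 IsSuffixArray T π → IsSuffixArray T ρ →
                 ∀ {i j} → i Fin.< j → (ρ ⟨$⟩ˡ (π ⟨$⟩ʳ i)) Fin.< (ρ ⟨$⟩ˡ (π ⟨$⟩ʳ j))
  reindex-mono T π ρ π-sa ρ-sa {i} {j} i<j
    with Fin.<-cmp (ρ ⟨$⟩ˡ (π ⟨$⟩ʳ i)) (ρ ⟨$⟩ˡ (π ⟨$⟩ʳ j))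
  ... | tri< lt _ _ = lt
  ... | tri≈ _ eq _ = contradiction
    (subst (λ p → suffix T (π ⟨$⟩ʳ i) ≺ suffix T p)
      (trans (sym (inverseʳ ρ)) (trans (cong (ρ ⟨$⟩ʳ_) (sym eq)) (inverseʳ ρ))) (π-sa i<j))
    ≺-irrefl
  ... | tri> _ _ gt = contradiction
    (subst₂ (λ p q → suffix T p ≺ suffix T q) (inverseʳ ρ) (inverseʳ ρ) (ρ-sa gt))
    (≺-asym (π-sa i<j))

suffixArray-unique : (T : Text σ n) (π ρ : Permutation′ n) →
                     IsSuffixArray T π → IsSuffixArray T ρ →
                     ∀ i → π ⟨$⟩ʳ i ≡ ρ ⟨$⟩ʳ i
suffixArray-unique T π ρ π-sa ρ-sa i =
  trans (sym (inverseʳ ρ)) (cong (ρ ⟨$⟩ʳ_) (Fin.≤-antisym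
    (subst (λ k → (ρ ⟨$⟩ˡ (π ⟨$⟩ʳ i)) Fin.≤ k) π⁻¹ρρ⁻¹π≡id
      (mono⇒inflationary _ (reindex-mono T ρ π ρ-sa π-sa) (ρ ⟨$⟩ˡ (π ⟨$⟩ʳ i))))
    (mono⇒inflationary _ (reindex-mono T π ρ π-sa ρ-sa) i)))
  where
  π⁻¹ρρ⁻¹π≡id : π ⟨$⟩ˡ (ρ ⟨$⟩ʳ (ρ ⟨$⟩ˡ (π ⟨$⟩ʳ i))) ≡ i
  π⁻¹ρρ⁻¹π≡id = trans (cong (π ⟨$⟩ˡ_) (inverseʳ ρ)) (inverseˡ π)

SA : Text σ n → Fin n → Fin n
SA T i = proj₁ (suffixArray-exists T) ⟨$⟩ʳ i

-- A data structure for a family of inputs; answer sees the stored bits and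
-- the query arguments but not the input. No bound is put on query time.
record DataStructure {Input Query Answer : Set}
                     (query : Input → Query → Answer) : Set where
  field
    encode  : Input → List Bool
    answer  : List Bool → Query → Answer
    correct : ∀ x q → answer (encode x) q ≡ query x q

  space : Input → ℕ
  space x = length (encode x)

-- For a rational δ = a / b ≥ 0 and σ ≥ 1 this is the inequality of reals
-- δ · n · log₂ σ ≤ s, with the denominator cleared and both sides
-- exponentiated to base 2: σ ^ (a · n) ≤ 2 ^ (b · s). For δ < 0 it is junk.
infix 4 _·_·log₂_≤_

_·_·log₂_≤_ : ℚ → ℕ → ℕ → ℕ → Set
δ · n ·log₂ σ ≤ s = σ ^ (∣ ↥ δ ∣ * n) ≤ 2 ^ (↧ₙ δ * s)

{-# OPTIONS --safe #-}

-- Put h = ⌊σ/2⌋ and let a text consist of n - h ≥ n/2 data letters followed by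
-- the reference letters 1, 3, …, 2h - 1. The data letters are taken from the
-- h + 1 ≥ √σ values 0, 2, …, capped at σ - 1. Comparing a data suffix with the
-- reference suffix at 2a + 1 tells whether the data letter is at most 2a, so the
-- suffix array determines the data, and any data structure has to store
-- (h + 1) ^ (n - h) ≥ σ ^ (n/4) different bit strings.
module Submission where

open import Data.Bool.Base using (Bool; true; false)
open import Data.Fin.Base as Fin using (Fin; zero; suc; toℕ; fromℕ<; _↑ˡ_; _↑ʳ_; finToFun; funToFin; combine)
open import Data.Fin.Permutation using (Permutation′; _⟨$⟩ʳ_; _⟨$⟩ˡ_; inverseʳ)
import Data.Fin.Properties as Fin
import Data.Integer.Base as ℤ
open import Data.List.Base using (List; []; _∷_; length; drop)
open import Data.List.Properties using (drop-all)
open import Data.List.Relation.Binary.Lex.Strict using (halt; this; next)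
open import Data.Nat.Base using (ℕ; zero; suc; _+_; _*_; _^_; _<_; _⊓_; _∸_; _/_; _%_; _≤_; s≤s; s<s⁻¹; s≤s⁻¹)
open import Data.Nat.Binary.Base as ℕᵇ using (ℕᵇ; 2[1+_]; 1+[2_])
import Data.Nat.Binary.Properties as ℕᵇ
open import Data.Nat.DivMod using (m≡m%n+[m/n]*n; m%n<n; m/n*n≤m; m/n≤m; /-monoˡ-≤)
open import Data.Nat.Properties
open import Data.Nat.Tactic.RingSolver using (solve-∀)
open import Data.Product.Base using (_×_; _,_; ∃-syntax; proj₁; proj₂)
open import Data.Rational.Base using (ℚ; 0ℚ) renaming (_<_ to _<ℚ_; _/_ to _/ℚ_)
import Data.Rational.Properties as ℚ
open import Data.Sum.Base using (inj₁; inj₂)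
open import Data.Vec.Base using (_∷_; _++_; lookup; tabulate; toList)
open import Data.Vec.Properties using (length-toList; lookup-++ˡ; lookup-++ʳ; lookup∘tabulate)
open import Function.Base using (_∘_)
open import Function.Definitions using (Injective)
open import Relation.Binary.Definitions using (tri<; tri≈; tri>)
open import Relation.Binary.PropositionalEquality
open import Relation.Nullary.Decidable using (yes; no)
open import Relation.Nullary.Negation using (contradiction; ¬_)
open import Defs

private
  variable
    m n σ : ℕ

-- Counting bit strings by length.

-- Bijective base 2, with `false` and `true` as the digits 1 and 2, least significant first. Having
-- no digit 0, it also separates strings of different lengths.
numeral : List Bool → ℕᵇ
numeral []           = ℕᵇ.zero
numeral (false ∷ bs) = 1+[2 numeral bs ]
numeral (true  ∷ bs) = 2[1+ numeral bs ]

numeral-injective : Injective _≡_ _≡_ numeral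
numeral-injective {[]}         {[]}         eq = refl
numeral-injective {[]}         {false ∷ _}  ()
numeral-injective {[]}         {true ∷ _}   ()
numeral-injective {false ∷ _}  {[]}         ()
numeral-injective {true ∷ _}   {[]}         ()
numeral-injective {false ∷ bs} {true ∷ _}   ()
numeral-injective {true ∷ bs}  {false ∷ _}  ()
numeral-injective {false ∷ bs} {false ∷ cs} eq = cong (false ∷_) (numeral-injective (ℕᵇ.1+[2_]-injective eq))
numeral-injective {true ∷ bs}  {true ∷ cs}  eq = cong (true ∷_) (numeral-injective (ℕᵇ.2[1+_]-injective eq))

numeral-bound : ∀ bs → 2 + ℕᵇ.toℕ (numeral bs) ≤ 2 ^ suc (length bs)
numeral-bound []           = ≤-refl
numeral-bound (false ∷ bs) = begin
  3 + 2 * ℕᵇ.toℕ (numeral bs)    ≤⟨ n≤1+n _ ⟩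
  4 + 2 * ℕᵇ.toℕ (numeral bs)    ≡⟨ *-distribˡ-+ 2 2 (ℕᵇ.toℕ (numeral bs)) ⟨
  2 * (2 + ℕᵇ.toℕ (numeral bs))  ≤⟨ *-monoʳ-≤ 2 (numeral-bound bs) ⟩
  2 ^ suc (suc (length bs))      ∎
  where open ≤-Reasoning
numeral-bound (true ∷ bs)  = begin
  2 + 2 * (1 + ℕᵇ.toℕ (numeral bs))  ≡⟨ *-distribˡ-+ 2 1 (1 + ℕᵇ.toℕ (numeral bs)) ⟨
  2 * (2 + ℕᵇ.toℕ (numeral bs))      ≤⟨ *-monoʳ-≤ 2 (numeral-bound bs) ⟩
  2 ^ suc (suc (length bs))          ∎
  where open ≤-Reasoning

-- If `2 ^ suc (length (e i))` never exceeded `n`, all numerals would lie below `n ∸ 1`, and the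
-- pigeonhole principle would give two equal strings.
injective⇒long : 0 < n → (e : Fin n → List Bool) → Injective _≡_ _≡_ e →
                 ∃[ i ] n < 2 ^ suc (length (e i))
injective⇒long {suc n} _ e e-inj with Fin.any? (λ i → suc n <? 2 ^ suc (length (e i)))
... | yes long  = long
... | no  ¬long = contradiction (e-inj (numeral-injective (ℕᵇ.toℕ-injective same))) (Fin.<⇒≢ i<j)
  where
  small : ∀ i → ℕᵇ.toℕ (numeral (e i)) < n
  small i = s≤s⁻¹ (≤-trans (numeral-bound (e i)) (≮⇒≥ (λ lt → ¬long (i , lt))))
  collision = Fin.pigeonhole (n<1+n n) (λ i → fromℕ< (small i))
  i<j = proj₁ (proj₂ (proj₂ collision))
  same = Fin.fromℕ<-injective _ _ _ _ (proj₂ (proj₂ (proj₂ collision)))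

-- Numbering words by an initial segment of the naturals.

-- Stands in for function extensionality.
funToFin-cong : {f g : Fin m → Fin n} → f ≗ g → funToFin f ≡ funToFin g
funToFin-cong {zero}  f≗g = refl
funToFin-cong {suc m} f≗g = cong₂ combine (f≗g zero) (funToFin-cong (f≗g ∘ suc))

finToFun-injective : {i j : Fin (n ^ m)} → finToFun {n} {m} i ≗ finToFun j → i ≡ j
finToFun-injective {n} {m} {i} {j} eq = trans (sym (Fin.funToFin-finToFin {m} {n} i))
  (trans (funToFin-cong eq) (Fin.funToFin-finToFin {m} {n} j))

-- Lexicographic comparison of suffixes and its recovery from the suffix array.

suffix-∷ : (T : Text σ n) (p : Fin n) → suffix T p ≡ lookup T p ∷ drop (suc (toℕ p)) (toList T)
suffix-∷ (x ∷ T) zero    = refl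
suffix-∷ (x ∷ T) (suc p) = suffix-∷ T p

lookup<⇒≺ : (T : Text σ n) (p q : Fin n) → lookup T p Fin.< lookup T q → suffix T p ≺ suffix T q
lookup<⇒≺ T p q lt = subst₂ _≺_ (sym (suffix-∷ T p)) (sym (suffix-∷ T q)) (this lt)

[]≺drop : ∀ k (xs : List (Fin σ)) → k < length xs → [] ≺ drop k xs
[]≺drop zero    (x ∷ xs) _  = halt
[]≺drop (suc k) (x ∷ xs) lt = []≺drop k xs (s<s⁻¹ lt)

-- The suffix at the final position is a single letter, hence a proper prefix of any longer suffix
-- with that first letter.
last≺ : (T : Text σ n) (p q : Fin n) → suc (toℕ q) ≡ n → toℕ p < toℕ q →
        lookup T q ≡ lookup T p → suffix T q ≺ suffix T p
last≺ {n = n} T p q last p<q eq = subst₂ _≺_ (sym (suffix-∷ T q)) (sym (suffix-∷ T p))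
  (next eq (subst (_≺ drop (suc (toℕ p)) (toList T))
    (sym (drop-all _ (toList T) (≤-reflexive (trans (length-toList T) (sym last)))))
    ([]≺drop _ (toList T) (subst (suc (toℕ p) <_) (sym (length-toList T))
      (subst (suc (toℕ p) <_) last (s≤s p<q))))))

-- Suffixes compare as their ranks `π ⟨$⟩ˡ p` and `π ⟨$⟩ˡ q` do, and the ranks depend on the
-- permutation alone.
suffixArray-determines-≺ : (T U : Text σ n) (π ρ : Permutation′ n) → IsSuffixArray T π → IsSuffixArray U ρ →
                           (π ⟨$⟩ʳ_) ≗ (ρ ⟨$⟩ʳ_) →
                           ∀ p q → suffix T p ≺ suffix T q → suffix U p ≺ suffix U q
suffixArray-determines-≺ T U π ρ π-sa ρ-sa π≗ρ p q p≺q
  with Fin.<-cmp (π ⟨$⟩ˡ p) (π ⟨$⟩ˡ q)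
... | tri< lt _ _ = subst₂ (λ i j → suffix U i ≺ suffix U j)
  (trans (sym (π≗ρ _)) (inverseʳ π)) (trans (sym (π≗ρ _)) (inverseʳ π)) (ρ-sa lt)
... | tri≈ _ eq _ = contradiction
  (subst (λ i → suffix T p ≺ suffix T i)
    (trans (sym (inverseʳ π)) (trans (cong (π ⟨$⟩ʳ_) (sym eq)) (inverseʳ π))) p≺q)
  ≺-irrefl
... | tri> _ _ gt = contradiction
  (subst₂ (λ i j → suffix T i ≺ suffix T j) (inverseʳ π) (inverseʳ π) (π-sa gt))
  (≺-asym p≺q)

SA-determines-≺ : (T U : Text σ n) → SA T ≗ SA U →
                  ∀ p q → suffix T p ≺ suffix T q → suffix U p ≺ suffix U q
SA-determines-≺ T U same p q = suffixArray-determines-≺ T U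
  (proj₁ (suffixArray-exists T)) (proj₁ (suffixArray-exists U))
  (proj₂ (suffixArray-exists T)) (proj₂ (suffixArray-exists U)) same p q

2+2a≤2b : ∀ {a b} → a < b → 2 + 2 * a ≤ 2 * b
2+2a≤2b {a} {b} a<b = subst (_≤ 2 * b) (*-suc 2 a) (*-monoʳ-≤ 2 a<b)

-- Texts of data and reference letters, reconstructed from their suffix arrays.

-- The alphabet size is `suc k`, and the two inequalities say that `h` is half of it, rounded down.
module _ {k h d : ℕ} (2h≤σ : 2 * h ≤ suc k) (k≤2h : k ≤ 2 * h) where

  reference-bound : (a : Fin h) → suc (2 * toℕ a) < suc k
  reference-bound a = ≤-trans (2+2a≤2b (Fin.toℕ<n a)) 2h≤σ

  reference : Fin h → Fin (suc k)
  reference a = fromℕ< (reference-bound a)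

  toℕ-reference : ∀ a → toℕ (reference a) ≡ suc (2 * toℕ a)
  toℕ-reference a = Fin.toℕ-fromℕ< (reference-bound a)

  -- The cap acts only for an even alphabet size: then `2 * h` is not a letter, and the largest
  -- datum coincides with the largest reference letter.
  datum : Fin (suc h) → Fin (suc k)
  datum a = fromℕ< (s≤s (m⊓n≤n (2 * toℕ a) k))

  toℕ-datum : ∀ a → toℕ (datum a) ≡ 2 * toℕ a ⊓ k
  toℕ-datum a = Fin.toℕ-fromℕ< (s≤s (m⊓n≤n (2 * toℕ a) k))

  text : (Fin d → Fin (suc h)) → Text (suc k) (d + h)
  text w = tabulate (datum ∘ w) ++ tabulate reference

  lookup-datum : ∀ w p → lookup (text w) (p ↑ˡ h) ≡ datum (w p)
  lookup-datum w p = trans (lookup-++ˡ (tabulate (datum ∘ w)) _ p) (lookup∘tabulate (datum ∘ w) p)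

  lookup-reference : ∀ w a → lookup (text w) (d ↑ʳ a) ≡ reference a
  lookup-reference w a = trans (lookup-++ʳ (tabulate (datum ∘ w)) _ a) (lookup∘tabulate reference a)

  datum≺reference : ∀ w p a → toℕ (w p) ≡ toℕ a →
                    suffix (text w) (p ↑ˡ h) ≺ suffix (text w) (d ↑ʳ a)
  datum≺reference w p a eq = lookup<⇒≺ (text w) _ _
    (subst₂ Fin._<_ (sym (lookup-datum w p)) (sym (lookup-reference w a)) (begin-strict
      toℕ (datum (w p))  ≡⟨ toℕ-datum (w p) ⟩
      2 * toℕ (w p) ⊓ k  ≤⟨ m⊓n≤m _ k ⟩
      2 * toℕ (w p)      ≡⟨ cong (2 *_) eq ⟩
      2 * toℕ a          <⟨ n<1+n _ ⟩
      suc (2 * toℕ a)    ≡⟨ toℕ-reference a ⟨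
      toℕ (reference a)  ∎))
    where open ≤-Reasoning

  reference≤datum : ∀ {a b} → toℕ a < toℕ b → toℕ (reference a) ≤ toℕ (datum b)
  reference≤datum {a} {b} a<b = begin
    toℕ (reference a)  ≡⟨ toℕ-reference a ⟩
    suc (2 * toℕ a)    ≤⟨ ⊓-glb (<⇒≤ (2+2a≤2b a<b)) (s<s⁻¹ (reference-bound a)) ⟩
    2 * toℕ b ⊓ k      ≡⟨ toℕ-datum b ⟨
    toℕ (datum b)      ∎
    where open ≤-Reasoning

  -- The placement of the references matters here: they stand last and increase, so the only one
  -- that can tie with a datum of larger index is the final letter of the text.
  reference≺datum : ∀ w p a → toℕ a < toℕ (w p) →
                    suffix (text w) (d ↑ʳ a) ≺ suffix (text w) (p ↑ˡ h)
  reference≺datum w p a a<wp with m≤n⇒m<n∨m≡n (reference≤datum {a} {w p} a<wp)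
  ... | inj₁ lt = lookup<⇒≺ (text w) _ _
    (subst₂ Fin._<_ (sym (lookup-reference w a)) (sym (lookup-datum w p)) lt)
  -- A tie forces the datum to be capped, so the reference is the last letter.
  ... | inj₂ eq = last≺ (text w) _ _ last
    (subst₂ _<_ (sym (Fin.toℕ-↑ˡ p h)) (sym (Fin.toℕ-↑ʳ d a)) (m≤n⇒m≤n+o (toℕ a) (Fin.toℕ<n p)))
    (trans (lookup-reference w a) (trans (Fin.toℕ-injective eq) (sym (lookup-datum w p))))
    where
    open ≤-Reasoning
    -- Otherwise both arguments of `⊓` exceed the reference letter, and so does the datum, against
    -- the tie.
    k≤1+2a : k ≤ suc (2 * toℕ a)
    k≤1+2a = ≮⇒≥ λ 1+2a<k → n≮n (suc (2 * toℕ a)) (begin-strict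
      suc (2 * toℕ a)    <⟨ ⊓-glb (2+2a≤2b a<wp) 1+2a<k ⟩
      2 * toℕ (w p) ⊓ k  ≡⟨ trans eq (toℕ-datum (w p)) ⟨
      toℕ (reference a)  ≡⟨ toℕ-reference a ⟩
      suc (2 * toℕ a)    ∎)

    -- From `2 * h ≤ suc k ≤ 2 + 2 * toℕ a` it follows that `a` is the largest index below `h`.
    last : suc (toℕ (d ↑ʳ a)) ≡ d + h
    last = trans (cong suc (Fin.toℕ-↑ʳ d a)) (trans (sym (+-suc d (toℕ a)))
      (cong (d +_) (≤-antisym (Fin.toℕ<n a) (*-cancelˡ-≤ 2 (begin
        2 * h            ≤⟨ 2h≤σ ⟩
        suc k            ≤⟨ s≤s k≤1+2a ⟩
        2 + 2 * toℕ a    ≡⟨ *-suc 2 (toℕ a) ⟨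
        2 * suc (toℕ a)  ∎)))))

  -- The reference with index `w p` follows position `p` in the suffix order of `text w` but
  -- precedes it in that of `text v`. It exists because `w p < v p ≤ h`.
  SA-determines-≮ : ∀ w v → SA (text w) ≗ SA (text v) → ∀ p → ¬ w p Fin.< v p
  SA-determines-≮ w v same p wp<vp = ≺-asym
    (reference≺datum v p a (subst (_< toℕ (v p)) (sym a≡wp) wp<vp))
    (SA-determines-≺ (text w) (text v) same (p ↑ˡ h) (d ↑ʳ a) (datum≺reference w p a (sym a≡wp)))
    where
    wp<h : toℕ (w p) < h
    wp<h = <-≤-trans wp<vp (Fin.toℕ≤pred[n] (v p))
    a = fromℕ< wp<h
    a≡wp = Fin.toℕ-fromℕ< wp<h

  SA∘text-injective : ∀ w v → SA (text w) ≗ SA (text v) → w ≗ v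
  SA∘text-injective w v same p with Fin.<-cmp (w p) (v p)
  ... | tri< lt _ _ = contradiction lt (SA-determines-≮ w v same p)
  ... | tri≈ _ eq _ = eq
  ... | tri> _ _ gt = contradiction gt (SA-determines-≮ v w (sym ∘ same) p)

-- From distinct codes to the space bound.

encode-separates : {Input Query Answer : Set} {query : Input → Query → Answer}
                   (D : DataStructure query) → let open DataStructure D in
                   ∀ {x y} → encode x ≡ encode y → query x ≗ query y
encode-separates D {x} {y} eq q =
  trans (sym (correct x q)) (trans (cong (λ bs → answer bs q) eq) (correct y q))
  where open DataStructure D

-- By `σ ≤ suc h ^ 2` and `d + h ≤ 2 * d`, the left side is at most the fourth power of `suc h ^ d`,
-- hence at most `2 ^ (4 * (1 + s))`.
σ^n≤2^8s : ∀ h d s → 1 ≤ h → h ≤ d → σ ≤ suc (2 * h) → suc h ^ d < 2 ^ suc s →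
           σ ^ (1 * (d + h)) ≤ 2 ^ (8 * s)
-- The estimate `4 * (1 + s) ≤ 8 * s` fails at 0, but this case is void: there are at least two data
-- words.
σ^n≤2^8s h d zero 1≤h h≤d σ≤ N<2 = contradiction N<2 (≤⇒≯ (begin
  2          ≡⟨⟩
  2 ^ 1      ≤⟨ ^-monoʳ-≤ 2 (≤-trans 1≤h h≤d) ⟩
  2 ^ d      ≤⟨ ^-monoˡ-≤ d (s≤s 1≤h) ⟩
  suc h ^ d  ∎))
  where open ≤-Reasoning
σ^n≤2^8s {σ} h d (suc s) 1≤h h≤d σ≤ N< = begin
  σ ^ (1 * (d + h))             ≤⟨ ^-monoˡ-≤ (1 * (d + h)) σ≤[1+h]^2 ⟩
  (suc h ^ 2) ^ (1 * (d + h))   ≡⟨ ^-*-assoc (suc h) 2 (1 * (d + h)) ⟩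
  suc h ^ (2 * (1 * (d + h)))   ≤⟨ ^-monoʳ-≤ (suc h) (*-monoʳ-≤ 2 (*-monoʳ-≤ 1 (+-monoʳ-≤ d h≤d))) ⟩
  suc h ^ (2 * (1 * (d + d)))   ≡⟨ cong (suc h ^_) (2[d+d]≡d*4 d) ⟩
  suc h ^ (d * 4)               ≡⟨ ^-*-assoc (suc h) d 4 ⟨
  (suc h ^ d) ^ 4               ≤⟨ ^-monoˡ-≤ 4 (<⇒≤ N<) ⟩
  (2 ^ suc (suc s)) ^ 4         ≡⟨ ^-*-assoc 2 (suc (suc s)) 4 ⟩
  2 ^ (suc (suc s) * 4)         ≤⟨ ^-monoʳ-≤ 2 (≤-trans (m≤m+n _ (s * 4)) (≤-reflexive (exponent s))) ⟩
  2 ^ (8 * suc s)               ∎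
  where
  open ≤-Reasoning
  square : ∀ h → 1 + 2 * h + h * h ≡ (1 + h) * ((1 + h) * 1)
  square = solve-∀
  2[d+d]≡d*4 : ∀ d → 2 * (1 * (d + d)) ≡ d * 4
  2[d+d]≡d*4 = solve-∀
  exponent : ∀ s → (2 + s) * 4 + s * 4 ≡ 8 * (1 + s)
  exponent = solve-∀
  σ≤[1+h]^2 : σ ≤ suc h ^ 2
  σ≤[1+h]^2 = ≤-trans σ≤ (≤-trans (m≤m+n _ (h * h)) (≤-reflexive (square h)))

-- Of the denominator 8, one factor 2 comes from `σ ≤ suc h ^ 2`, one from `d + h ≤ 2 * d`, and one
-- from `1 + s ≤ 2 * s`.
δ : ℚ
δ = ℤ.+ 1 /ℚ 8

space-bound : ∀ {k h d} → 1 ≤ h → h ≤ d → 2 * h ≤ suc k → k ≤ 2 * h →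
              (D : DataStructure (SA {suc k} {d + h})) →
              ∃[ T ] (δ · d + h ·log₂ suc k ≤ DataStructure.space D T)
space-bound {k} {h} {d} 1≤h h≤d 2h≤σ k≤2h D =
  let i , N<2^[1+s] = injective⇒long (m^n>0 (suc h) d) (encode ∘ T) encode∘T-injective
  in T i , σ^n≤2^8s h d (space (T i)) 1≤h h≤d (s≤s k≤2h) N<2^[1+s]
  where
  open DataStructure D
  T : Fin (suc h ^ d) → Text (suc k) (d + h)
  T i = text {h = h} {d} 2h≤σ k≤2h (finToFun i)
  encode∘T-injective : Injective _≡_ _≡_ (encode ∘ T)
  encode∘T-injective eq =
    finToFun-injective {m = d} (SA∘text-injective {h = h} {d} 2h≤σ k≤2h _ _ (encode-separates D eq))

theorem5p4 : ∃[ δ ] (0ℚ <ℚ δ) ×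
    (∀ (σ n : ℕ) → 2 ≤ σ → σ ≤ n →
    (D : DataStructure (SA {σ} {n})) →
    ∃[ T ] (δ · n ·log₂ σ ≤ DataStructure.space D T))
theorem5p4 = δ , ℚ.positive⁻¹ δ , bound
  where
  bound : ∀ σ n → 2 ≤ σ → σ ≤ n → (D : DataStructure (SA {σ} {n})) →
          ∃[ T ] (δ · n ·log₂ σ ≤ DataStructure.space D T)
  -- There are `n ∸ h` data letters; the transport turns the length `n ∸ h + h` into `n`.
  bound σ@(suc k) n 2≤σ σ≤n = subst
    (λ n → (D : DataStructure (SA {σ} {n})) → ∃[ T ] (δ · n ·log₂ σ ≤ DataStructure.space D T))
    (m∸n+n≡m h≤n) (space-bound 1≤h h≤n∸h 2h≤σ k≤2h)
    where
    open ≤-Reasoning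
    h = σ / 2
    2h≤σ : 2 * h ≤ σ
    2h≤σ = subst (_≤ σ) (*-comm h 2) (m/n*n≤m σ 2)
    k≤2h : k ≤ 2 * h
    k≤2h = s≤s⁻¹ (begin
      σ              ≡⟨ m≡m%n+[m/n]*n σ 2 ⟩
      σ % 2 + h * 2  ≤⟨ +-monoˡ-≤ (h * 2) (s≤s⁻¹ (m%n<n σ 2)) ⟩
      suc (h * 2)    ≡⟨ cong suc (*-comm h 2) ⟩
      suc (2 * h)    ∎)
    1≤h : 1 ≤ h
    1≤h = /-monoˡ-≤ 2 2≤σ
    h≤n : h ≤ n
    h≤n = ≤-trans (m/n≤m σ 2) σ≤n
    h≤n∸h : h ≤ n ∸ h
    h≤n∸h = m+n≤o⇒m≤o∸n h (begin
      h + h  ≡⟨ cong (λ x → h + x) (+-identityʳ h) ⟨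
      2 * h  ≤⟨ 2h≤σ ⟩
      σ      ≤⟨ σ≤n ⟩
      n      ∎)
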